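{- Let $D=(N,A)$, $\mathcal{K}$, $\{D^k\}_{k\in\mathcal{K}}$ be an instance of SND-RR with time horizon $T$, and let $D_S=(N_S,A_S\cup H_S)$ be a partial network satisfying properties (P1) and (P2) below. Then the optimal value of SND-RR$(D_S)$ is a lower bound on the optimal value of SND-RR$(D_T)$. (P1) For all $k\in\mathcal{K}$, $(o_k,r_k)\in N_S$ and $(d_k,l_k)\in N_S$; for all $v\in N$, $(v,0)\in N_S$ and $(v,T)\in N_S$. (P2) For all $vw\in A$ and all $(v,t)\in N_S$ with $t+\tau_{vw}\le T$, we have $((v,t),(w,t'))\in A_S$ where $t'=\max\{r: r\le t+\tau_{vw},\ (w,r)\in N_S\}$.
   Context: An instance of SND-RR (service network design with restricted routes) consists of: a directed graph $D=(N,A)$ (the flat network); for each arc $vw\in A$ a transit time $\tau_{vw}\in\mathbb{Z}_{>0}$, a fixed cost $f_{vw}>0$, a capacity $u_{vw}\in\mathbb{Z}_{>0}$, and for each commodity $k$ a per-unit cost $c^k_{vw}>0$; a set $\mathcal{K}$ of commodities, each $k$ with origin $o_k\in N$, destination $d_k\in N$, demand $q_k$, release time $r_k$ and deadline $l_k$ (integers, earliest release time $0$); and for each $k$ a subgraph $D^k=(N^k,A^k)\subseteq D$. Let $T=\max_k l_k$ and $[T]=\{0,1,\dots,T\}$. The (full) time-expanded network $D_T=(N_T,A_T\cup H_T)$ has $N_T=\{(v,t):v\in N,t\in[T]\}$, movement arcs $A_T=\{((v,t),(w,t+\tau_{vw})): (v,t)\in N_T, vw\in A, t+\tau_{vw}\le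 T\}$ and storage (holdover) arcs $H_T=\{((v,t),(v,t+1)): v\in N, t\in\{0,\dots,T-1\}\}$. $D^k_T=(N^k_T,A^k_T\cup H^k_T)$ is the time-expanded network of $D^k$. For a timed arc $a=((v,t),(w,t'))$ write $u_a=u_{vw}$, $f_a=f_{vw}$, $c^k_a=c^k_{vw}$, $\tau_a=\tau_{vw}$. For a graph $H$ and timed node $(v,t)$, $\delta^+_H(v,t)$, $\delta^-_H(v,t)$ denote outgoing/incoming timed arcs, and $x^k(S)=\sum_{a\in S}x^k_a$. SND-RR$(D_T)$ is the integer program: minimize $\sum_{a\in A_T}f_ay_a+\sum_{a\in A_T}\sum_{k}c^k_aq_kx^k_a$ subject to, for all $k$ and $(v,t)\in N^k_T$: $x^k(\delta^+_{D^k_T}(v,t))-x^k(\delta^-_{D^k_T}(v,t))$ equals $1$ if $(v,t)=(o_k,r_k)$, $-1$ if $(v,t)=(d_k,l_k)$, $0$ otherwise; $\sum_k q_kx^k_a\le u_ay_a$ for all $a\in A_T$; $x^k_a\in\{0,1\}$ for $a\in A^k_T\cup H^k_T$ (and $x^k_a=0$ otherwise); $y_a\in\mathbb{Z}_{\ge0}$. A partial network is a directed graph $D_S=(N_S,A_S\cup H_S)$ with $N_S\subseteq N_T$, $A_S\subseteq\{((v,t),(w,t')):(v,t)\in N_T, vw\in A, t'\le t+\tau_{vw}\le T\}$, and $H_S$ the arcs joining each timed node $(v,t)\in N_S$ to the next copy $(v,t'')\in N_S$ of $v$ (smallest $t''>t$). For each $k$, $D^k_S=(N^k_S,A^k_S\cup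 H^k_S)$ with $N^k_S=\{(v,t)\in N_S: v\in N^k\}$, $A^k_S=\{((v,t),(w,t'))\in A_S: vw\in A^k\}$, $H^k_S=\{((v,t),(v,t'))\in H_S: v\in N^k\}$. For $a=((v,t),(w,t'))\in A_S$, $\tau_a=\tau_{vw}$ (not $t'-t$). SND-RR$(D_S)$ is the integer program: minimize $\sum_{a\in A_S}f_ay_a+\sum_{a\in A_S}\sum_kc^k_aq_kx^k_a$ subject to, for all $k$ and $(v,t)\in N^k_S$: $x^k(\delta^+_{D^k_S}(v,t))-x^k(\delta^-_{D^k_S}(v,t))$ equals $1$ if $(v,t)=(o_k,r_k)$, $-1$ if $(v,t)=(d_k,l_k)$, $0$ otherwise; $\sum_kq_kx^k_a\le u_ay_a$ for all $a\in A_S$; $\sum_{a\in A^k_S}\tau_ax^k_a\le l_k-r_k$ for all $k$; $x^k_a\in\{0,1\}$ for $a\in A^k_S\cup H^k_S$ (and $0$ otherwise); $y_a\in\mathbb{Z}_{\ge0}$.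
   Formalization: It is additionally assumed that each commodity's origin and destination lie in its own subgraph D^k; otherwise, if both lie outside and the deadline precedes the release time, x^k = 0 is feasible for D_T while the duration constraint makes D_S infeasible. -}

module Defs where

open import Level using (Level; 0ℓ; suc; _⊔_)
open import Algebra.Bundles using (AbelianGroup)
open import Algebra.Structures using (IsAbelianGroup)
import Algebra.Properties.Monoid.Mult as Mult
open import Data.Bool.Base using (if_then_else_)
open import Data.Fin.Base using (Fin)
import Data.Fin.Properties as Fin
open import Data.Integer.Base as ℤ using (ℤ; +_; 0ℤ; 1ℤ; -1ℤ)
open import Data.List.Base
  using (List; map; foldr; filter; _++_; allFin; upTo; cartesianProduct)
open import Data.List.Extrema.Nat using (max)
open import Data.Nat.Base using (ℕ; _≤_; _<_) renaming (_+_ to _+ℕ_; _*_ to _*ℕ_)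
open import Data.Nat.ListAction using (sum)
import Data.Nat.Properties as ℕ
open import Data.Product.Base using (∃; _×_; _,_; uncurry)
open import Data.Product.Properties using (≡-dec)
open import Data.Sum.Base using (_⊎_)
open import Relation.Binary.Core using (Rel)
import Relation.Binary.Definitions as Binary
open import Relation.Binary.PropositionalEquality.Core using (_≡_)
open import Relation.Binary.Structures using (IsTotalOrder)
import Relation.Binary.Construct.Add.Supremum.NonStrict as AddSupremum
import Relation.Binary.Construct.NonStrictToStrict as ToStrict
open import Relation.Nullary using (¬_; does)
open import Relation.Nullary.Construct.Add.Supremum using (_⁺; ⊤⁺; [_])
open import Relation.Nullary.Decidable using (map′; ¬?; _×-dec_)
open import Relation.Unary using (Pred)
import Relation.Unary as Unary

-- The domain of the costs. Cost coefficients are only added and multiplied by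
-- natural numbers, so no further structure is needed; the additive groups of
-- ℝ, of ℚ and of every other ordered field are instances.

record OrderedAbelianGroup (c ℓ₁ ℓ₂ : Level) : Set (suc (c ⊔ ℓ₁ ⊔ ℓ₂)) where
  infix  8 -_
  infixl 6 _+_
  infix  4 _≈_ _≤ᶜ_
  field
    Carrier        : Set c
    _≈_            : Rel Carrier ℓ₁
    _≤ᶜ_           : Rel Carrier ℓ₂
    _+_            : Carrier → Carrier → Carrier
    0#             : Carrier
    -_             : Carrier → Carrier
    isAbelianGroup : IsAbelianGroup _≈_ _+_ 0# -_
    isTotalOrder   : IsTotalOrder _≈_ _≤ᶜ_
    +-monoˡ-≤      : ∀ z {x y} → x ≤ᶜ y → (x + z) ≤ᶜ (y + z)

  abelianGroup : AbelianGroup c ℓ₁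
  abelianGroup = record { isAbelianGroup = isAbelianGroup }

  open ToStrict _≈_ _≤ᶜ_ public using () renaming (_<_ to infix 4 _<ᶜ_)
  open AddSupremum _≤ᶜ_ public using (_≤⁺_)
  open Mult (AbelianGroup.monoid abelianGroup) public
    using () renaming (_×_ to infixr 8 _·_)

  ∑ : ∀ {a} {A : Set a} → List A → (A → Carrier) → Carrier
  ∑ as g = foldr (λ a s → g a + s) 0# as

∑ℕ : ∀ {a} {A : Set a} → List A → (A → ℕ) → ℕ
∑ℕ as g = sum (map g as)

module _ {c ℓ₁ ℓ₂} (C : OrderedAbelianGroup c ℓ₁ ℓ₂) where
  open OrderedAbelianGroup C

  record MinimizationProgram : Set (suc 0ℓ ⊔ c) where
    field
      Solution : Set
      Feasible : Pred Solution 0ℓ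
      cost     : Solution → Carrier

  open MinimizationProgram using (Feasible; cost)

  -- An infeasible program has value +∞, written ⊤⁺. A value −∞ is not
  -- provided for: the programs below have nonnegative objectives.

  data IsOptimalValue (P : MinimizationProgram) : Carrier ⁺ → Set (c ⊔ ℓ₁ ⊔ ℓ₂) where
    attained   : ∀ {z} → (∃ λ s → Feasible P s × cost P s ≈ z) →
                 (∀ s → Feasible P s → z ≤ᶜ cost P s) →
                 IsOptimalValue P [ z ]
    infeasible : (∀ s → ¬ Feasible P s) → IsOptimalValue P ⊤⁺

-- The vertex set is a subset of Fin n, so subgraphs need not be spanning.

record Digraph (n : ℕ) : Set₁ where
  field
    Vertex   : Pred (Fin n) 0ℓ
    Vertex?  : Unary.Decidable Vertex
    Arc      : Rel (Fin n) 0ℓ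
    Arc?     : Binary.Decidable Arc
    incident : ∀ {v w} → Arc v w → Vertex v × Vertex w

record _⊆ᴳ_ {n} (G H : Digraph n) : Set where
  field
    vertices : ∀ {v} → Digraph.Vertex G v → Digraph.Vertex H v
    arcs     : ∀ {v w} → Digraph.Arc G v w → Digraph.Arc H v w

TimedNode : ℕ → Set
TimedNode n = Fin n × ℕ

_≟ᵀ_ : ∀ {n} → Binary.DecidableEquality (TimedNode n)
_≟ᵀ_ = ≡-dec Fin._≟_ ℕ._≟_

-- Movement and storage arcs carry different tags, so that a movement arc along
-- a loop vv is never identified with a storage arc at v.

data TimedArc (n : ℕ) : Set where
  move hold : (p q : TimedNode n) → TimedArc n

record TimedNetwork (n : ℕ) : Set₁ where
  field
    Node  : Pred (TimedNode n) 0ℓ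
    Move  : Rel (TimedNode n) 0ℓ
    Move? : Binary.Decidable Move
    Hold  : Rel (TimedNode n) 0ℓ
    Hold? : Binary.Decidable Hold

  HasArc : Pred (TimedArc n) 0ℓ
  HasArc (move p q) = Move p q
  HasArc (hold p q) = Hold p q

-- m = min { i : P i }  and  m = max { i : P i }

IsMin IsMax : Pred ℕ 0ℓ → Pred ℕ 0ℓ
IsMin P m = P m × (∀ {i} → P i → m ≤ i)
IsMax P m = P m × (∀ {i} → P i → i ≤ m)

isMin? : ∀ {P} → Unary.Decidable P → Unary.Decidable (IsMin P)
isMin? {P} P? m =
  map′ (λ (Pm , none) → Pm , λ {i} Pi → ℕ.≮⇒≥ λ i<m → none {i} i<m Pi)
       (λ (Pm , least) → Pm , λ {i} i<m Pi → ℕ.<⇒≱ i<m (least {i} Pi))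
       (P? m ×-dec ℕ.allUpTo? (λ i → ¬? (P? i)) m)

_restrictedTo_ : ∀ {n} → TimedNetwork n → Digraph n → TimedNetwork n
N restrictedTo G = record
  { Node  = λ (v , t) → N.Node (v , t) × G.Vertex v
  ; Move  = λ (v , t) (w , t′) → N.Move (v , t) (w , t′) × G.Arc v w
  ; Move? = λ (v , t) (w , t′) → N.Move? (v , t) (w , t′) ×-dec G.Arc? v w
  ; Hold  = λ (v , t) (w , t′) → N.Hold (v , t) (w , t′) × G.Vertex v
  ; Hold? = λ (v , t) (w , t′) → N.Hold? (v , t) (w , t′) ×-dec G.Vertex? v
  }
  where
  module N = TimedNetwork N
  module G = Digraph G

module _ {c ℓ₁ ℓ₂} (C : OrderedAbelianGroup c ℓ₁ ℓ₂) where
  open OrderedAbelianGroup C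

  -- τ, f, u and cost are total functions for convenience; their values at pairs
  -- that are not arcs are unconstrained and never enter the programs.

  record Instance : Set (suc 0ℓ ⊔ c ⊔ ℓ₁ ⊔ ℓ₂) where
    field
      n      : ℕ
      D      : Digraph n

    open Digraph D public

    field
      τ      : Fin n → Fin n → ℕ
      f      : Fin n → Fin n → Carrier
      u      : Fin n → Fin n → ℕ
      τ-pos  : ∀ {v w} → Arc v w → 0 < τ v w
      f-pos  : ∀ {v w} → Arc v w → 0# <ᶜ f v w
      u-pos  : ∀ {v w} → Arc v w → 0 < u v w

      κ      : ℕ

    Commodity : Set
    Commodity = Fin κ

    field
      cost   : Commodity → Fin n → Fin n → Carrier
      c-pos  : ∀ k {v w} → Arc v w → 0# <ᶜ cost k v w
      o d    : Commodity → Fin n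
      q r l  : Commodity → ℕ
      r-min  : ∃ λ k → r k ≡ 0

      Dᵏ     : Commodity → Digraph n
      Dᵏ⊆D   : ∀ k → Dᵏ k ⊆ᴳ D

      -- Without these two, the flow constraints at o k and d k would be void.
      o∈Dᵏ   : ∀ k → Digraph.Vertex (Dᵏ k) (o k)
      d∈Dᵏ   : ∀ k → Digraph.Vertex (Dᵏ k) (d k)

    T : ℕ
    T = max 0 (map l (allFin κ))

  module _ (I : Instance) where
    open Instance I

    timeExpanded : Digraph n → TimedNetwork n
    timeExpanded G = record
      { Node  = λ (v , t) → G.Vertex v × t ≤ T
      ; Move  = λ (v , t) (w , t′) → G.Arc v w × t′ ≡ t +ℕ τ v w × t′ ≤ T
      ; Move? = λ (v , t) (w , t′) →
                  G.Arc? v w ×-dec t′ ℕ.≟ t +ℕ τ v w ×-dec t′ ℕ.≤? T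
      ; Hold  = λ (v , t) (w , t′) → G.Vertex v × w ≡ v × t′ ≡ ℕ.suc t × t′ ≤ T
      ; Hold? = λ (v , t) (w , t′) →
                  G.Vertex? v ×-dec w Fin.≟ v ×-dec t′ ℕ.≟ ℕ.suc t ×-dec t′ ℕ.≤? T
      }
      where module G = Digraph G

    D-T : TimedNetwork n
    D-T = timeExpanded D

    D-Tᵏ : Commodity → TimedNetwork n
    D-Tᵏ k = timeExpanded (Dᵏ k)

    record PartialNetwork : Set₁ where
      field
        Nodeˢ     : Pred (TimedNode n) 0ℓ
        Nodeˢ?    : Unary.Decidable Nodeˢ
        nodeˢ     : ∀ {v t} → Nodeˢ (v , t) → Vertex v × t ≤ T
        Moveˢ     : Rel (TimedNode n) 0ℓ
        Moveˢ?    : Binary.Decidable Moveˢ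
        incidentˢ : ∀ {p q} → Moveˢ p q → Nodeˢ p × Nodeˢ q
        moveˢ     : ∀ {v t w t′} → Moveˢ (v , t) (w , t′) →
                    Arc v w × t′ ≤ t +ℕ τ v w × t +ℕ τ v w ≤ T

      NextCopy : Fin n → ℕ → Pred ℕ 0ℓ
      NextCopy v t = IsMin (λ s → t < s × Nodeˢ (v , s))

      D-S : TimedNetwork n
      D-S = record
        { Node  = Nodeˢ
        ; Move  = Moveˢ
        ; Move? = Moveˢ?
        ; Hold  = λ (v , t) (w , t′) → Nodeˢ (v , t) × w ≡ v × NextCopy v t t′
        ; Hold? = λ (v , t) (w , t′) →
                    Nodeˢ? (v , t) ×-dec w Fin.≟ v
                      ×-dec isMin? (λ s → t ℕ.<? s ×-dec Nodeˢ? (v , s)) t′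
        }

      D-Sᵏ : Commodity → TimedNetwork n
      D-Sᵏ k = D-S restrictedTo Dᵏ k

    -- All pairs (v , t) with t ∈ [T]; every network considered lives on these.

    timedNodes : List (TimedNode n)
    timedNodes = cartesianProduct (allFin n) (upTo (ℕ.suc T))

    module _ (N : TimedNetwork n) where
      open TimedNetwork N

      moves : List (TimedNode n × TimedNode n)
      moves = filter (uncurry Move?) (cartesianProduct timedNodes timedNodes)

      δ⁺ δ⁻ : TimedNode n → List (TimedArc n)
      δ⁺ p = map (move p) (filter (Move? p) timedNodes)
          ++ map (hold p) (filter (Hold? p) timedNodes)
      δ⁻ p = map (λ p′ → move p′ p) (filter (λ p′ → Move? p′ p) timedNodes)
          ++ map (λ p′ → hold p′ p) (filter (λ p′ → Hold? p′ p) timedNodes)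

    balance : Commodity → TimedNode n → ℤ
    balance k p =
      if does (p ≟ᵀ (o k , r k)) then 1ℤ else
      if does (p ≟ᵀ (d k , l k)) then -1ℤ else 0ℤ

    record Solution : Set where
      field
        x : Commodity → TimedArc n → ℕ
        y : TimedNode n → TimedNode n → ℕ

    -- The constraints common to both programs, on a network N with
    -- commodity subnetworks Nᵏ.

    record IsFlowDesign (N : TimedNetwork n) (Nᵏ : Commodity → TimedNetwork n)
                        (s : Solution) : Set where
      open Solution s
      field
        conservation : ∀ k p → TimedNetwork.Node (Nᵏ k) p →
          + ∑ℕ (δ⁺ (Nᵏ k) p) (x k) ℤ.- + ∑ℕ (δ⁻ (Nᵏ k) p) (x k) ≡ balance k p
        capacity : ∀ {v t w t′} → TimedNetwork.Move N (v , t) (w , t′) →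
          ∑ℕ (allFin κ) (λ k → q k *ℕ x k (move (v , t) (w , t′)))
            ≤ u v w *ℕ y (v , t) (w , t′)
        binary  : ∀ k a → TimedNetwork.HasArc (Nᵏ k) a → x k a ≡ 0 ⊎ x k a ≡ 1
        outside : ∀ k a → ¬ TimedNetwork.HasArc (Nᵏ k) a → x k a ≡ 0

    totalCost : TimedNetwork n → Solution → Carrier
    totalCost N s =
      ∑ (moves N) (λ ((v , t) , (w , t′)) → y (v , t) (w , t′) · f v w)
      + ∑ (moves N) (λ ((v , t) , (w , t′)) →
          ∑ (allFin κ) λ k → (q k *ℕ x k (move (v , t) (w , t′))) · cost k v w)
      where open Solution s

    SND-RR-T : MinimizationProgram C
    SND-RR-T = record
      { Solution = Solution
      ; Feasible = IsFlowDesign D-T D-Tᵏ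
      ; cost     = totalCost D-T
      }

    module _ (S : PartialNetwork) where
      open PartialNetwork S

      WithinDuration : Pred Solution 0ℓ
      WithinDuration s = ∀ k →
        + ∑ℕ (moves (D-Sᵏ k))
             (λ ((v , t) , (w , t′)) → τ v w *ℕ x k (move (v , t) (w , t′)))
          ℤ.≤ + l k ℤ.- + r k
        where open Solution s

      SND-RR-S : MinimizationProgram C
      SND-RR-S = record
        { Solution = Solution
        ; Feasible = λ s →
            IsFlowDesign D-S D-Sᵏ s × WithinDuration s
        ; cost     = totalCost D-S
        }

      record P1 : Set where
        field
          origin      : ∀ k → Nodeˢ (o k , r k)
          destination : ∀ k → Nodeˢ (d k , l k)
          start       : ∀ v → Vertex v → Nodeˢ (v , 0)
          end         : ∀ v → Vertex v → Nodeˢ (v , T)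

      P2 : Set
      P2 = ∀ {v w} → Arc v w → ∀ {t} → Nodeˢ (v , t) → t +ℕ τ v w ≤ T →
           ∃ λ t′ → IsMax (λ s → s ≤ t +ℕ τ v w × Nodeˢ (w , s)) t′
                  × Moveˢ (v , t) (w , t′)

{-# OPTIONS --safe #-}
module Submission where

-- Round every time t at a location v down to the latest time at which v has a
-- copy in N_S. By (P2) a movement arc of D_T rounds to a movement arc of D_S,
-- which may arrive early, and storage arcs of D_S make up for the difference.
-- Arcs of D_T move forward in time, so the flow of a commodity in D_T contains
-- a path from its origin to its destination, and rounding turns this path into
-- a walk of D_S with the same transit times. The walk may repeat timed nodes;
-- removing its loops makes the flow binary and only decreases time and cost.
-- The capacity installed on an arc of D_S is the total capacity of the arcs of
-- D_T rounded to it.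

open import Defs
open import Level using (Level)
open import Algebra.Bundles using (AbelianGroup)
import Algebra.Properties.CommutativeSemigroup
import Algebra.Properties.Group
import Algebra.Properties.Monoid.Mult
open import Data.Bool.Base using (if_then_else_)
open import Data.Fin.Base using (Fin)
open import Data.Integer.Base as ℤ using (0ℤ; 1ℤ)
import Data.Integer.Properties as ℤ
open import Data.List.Base
  using (List; []; _∷_; _++_; map; filter; cartesianProduct; allFin; upTo)
open import Data.List.Membership.Propositional using (_∈_; _∉_)
import Data.List.Membership.Propositional.Properties as ∈ₚ
open import Data.List.Properties using (map-++; map-∘)
open import Data.List.Relation.Binary.Sublist.Propositional
  using (_⊆_; []; _∷_; _∷ʳ_; ⊆-refl; ⊆-trans)
import Data.List.Relation.Binary.Sublist.Propositional.Properties as ⊆ₚ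
open import Data.List.Relation.Unary.All as All using (All; []; _∷_)
open import Data.List.Relation.Unary.AllPairs using ([]; _∷_)
open import Data.List.Relation.Unary.Any using (here; there)
open import Data.List.Relation.Unary.Unique.Propositional using (Unique)
import Data.List.Relation.Unary.Unique.Propositional.Properties as Unique
open import Data.Nat.Base
  using (ℕ; zero; suc; _+_; _*_; _∸_; _≤_; _<_; _≤′_; z≤n; s≤s; ≤′-reflexive; ≤′-step)
open import Data.Nat.ListAction using (sum)
open import Data.Nat.ListAction.Properties using (sum-++)
open import Data.Nat.Properties
open import Data.Product.Base using (∃; _×_; _,_; proj₁; proj₂; uncurry)
open import Data.Product.Properties using (≡-dec)
open import Data.Sum.Base using (_⊎_; inj₁; inj₂)
open import Function.Base using (_∘_)
open import Relation.Binary.Bundles using (Poset)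
open import Relation.Binary.Construct.Add.Supremum.NonStrict using ([_]; _≤⊤⁺)
open import Relation.Binary.Construct.Closure.ReflexiveTransitive
  using (Star; ε; _◅_; _◅◅_; kleisliStar)
open import Relation.Binary.Definitions using (DecidableEquality)
open import Relation.Binary.PropositionalEquality
  using (_≡_; _≢_; refl; sym; trans; cong; cong₂; subst; subst₂; ≢-sym; module ≡-Reasoning)
import Relation.Binary.Reasoning.PartialOrder
open import Relation.Binary.Structures using (IsTotalOrder)
open import Relation.Nullary using (¬_; Dec; yes; no; does; contradiction)
open import Relation.Nullary.Decidable using (map′; _×-dec_; dec-true; dec-false)

private
  variable
    a b : Level
    A B : Set a

  module +-CS = Algebra.Properties.CommutativeSemigroup +-commutativeSemigroup
  module *-CS = Algebra.Properties.CommutativeSemigroup *-commutativeSemigroup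
  module ℤ-+ = Algebra.Properties.Group (AbelianGroup.group ℤ.+-0-abelianGroup)

Unique-resp-⊆ : ∀ {as bs : List A} → as ⊆ bs → Unique bs → Unique as
Unique-resp-⊆ []             []       = []
Unique-resp-⊆ (b ∷ʳ as⊆bs)   (_ ∷ u)  = Unique-resp-⊆ as⊆bs u
Unique-resp-⊆ (refl ∷ as⊆bs) (b∉ ∷ u) = ⊆ₚ.All-resp-⊆ as⊆bs b∉ ∷ Unique-resp-⊆ as⊆bs u

-- Finite sums and multiplicities

∑ℕ-cong : ∀ (as : List A) {g h} → (∀ {a} → a ∈ as → g a ≡ h a) → ∑ℕ as g ≡ ∑ℕ as h
∑ℕ-cong []       g≡h = refl
∑ℕ-cong (a ∷ as) g≡h = cong₂ _+_ (g≡h (here refl)) (∑ℕ-cong as (g≡h ∘ there))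

∑ℕ-mono : ∀ (as : List A) {g h} → (∀ {a} → a ∈ as → g a ≤ h a) → ∑ℕ as g ≤ ∑ℕ as h
∑ℕ-mono []       g≤h = z≤n
∑ℕ-mono (a ∷ as) g≤h = +-mono-≤ (g≤h (here refl)) (∑ℕ-mono as (g≤h ∘ there))

∑ℕ-zero : ∀ (as : List A) → ∑ℕ as (λ _ → 0) ≡ 0
∑ℕ-zero []       = refl
∑ℕ-zero (a ∷ as) = ∑ℕ-zero as

∑ℕ-++ : ∀ (as bs : List A) g → ∑ℕ (as ++ bs) g ≡ ∑ℕ as g + ∑ℕ bs g
∑ℕ-++ as bs g rewrite map-++ g as bs = sum-++ (map g as) (map g bs)

∑ℕ-+ : ∀ (as : List A) g h → ∑ℕ as (λ a → g a + h a) ≡ ∑ℕ as g + ∑ℕ as h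
∑ℕ-+ []       g h = refl
∑ℕ-+ (a ∷ as) g h = trans (cong (g a + h a +_) (∑ℕ-+ as g h))
                          (+-CS.interchange (g a) (h a) (∑ℕ as g) (∑ℕ as h))

*-distribˡ-∑ℕ : ∀ m (as : List A) g → m * ∑ℕ as g ≡ ∑ℕ as (λ a → m * g a)
*-distribˡ-∑ℕ m []       g = *-zeroʳ m
*-distribˡ-∑ℕ m (a ∷ as) g = trans (*-distribˡ-+ m (g a) _)
                                   (cong (m * g a +_) (*-distribˡ-∑ℕ m as g))

∑ℕ-swap : ∀ (as : List A) (bs : List B) (g : A → B → ℕ) →
          ∑ℕ as (λ a → ∑ℕ bs (g a)) ≡ ∑ℕ bs (λ b → ∑ℕ as (λ a → g a b))
∑ℕ-swap []       bs g = sym (∑ℕ-zero bs)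
∑ℕ-swap (a ∷ as) bs g = trans (cong (∑ℕ bs (g a) +_) (∑ℕ-swap as bs g))
                              (sym (∑ℕ-+ bs (g a) _))

∑ℕ-⊆ : ∀ {as bs : List A} → as ⊆ bs → ∀ g → ∑ℕ as g ≤ ∑ℕ bs g
∑ℕ-⊆ []               g = z≤n
∑ℕ-⊆ (b ∷ʳ as⊆bs)     g = m≤n⇒m≤o+n (g b) (∑ℕ-⊆ as⊆bs g)
∑ℕ-⊆ (refl ∷ as⊆bs)   g = +-monoʳ-≤ _ (∑ℕ-⊆ as⊆bs g)

∑ℕ-positive : ∀ (as : List A) {g} → 0 < ∑ℕ as g → ∃ λ a → a ∈ as × 0 < g a
∑ℕ-positive (a ∷ as) {g} 0<∑ with g a in eq
... | suc m = a , here refl , subst (0 <_) (sym eq) (s≤s z≤n)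
... | zero  = let a′ , a′∈as , 0<ga′ = ∑ℕ-positive as 0<∑ in a′ , there a′∈as , 0<ga′

∈⇒≤∑ℕ : ∀ {as : List A} {a} g → a ∈ as → g a ≤ ∑ℕ as g
∈⇒≤∑ℕ g (here refl)  = m≤m+n (g _) _
∈⇒≤∑ℕ g (there a∈as) = m≤n⇒m≤o+n (g _) (∈⇒≤∑ℕ g a∈as)

-- Leads from the subtraction-free balance of a walk to the integer form of the flow constraints:
-- adding `b` to both terms changes no difference, and then `m₂` cancels.
difference : ∀ a b {m₁ m₂} → m₁ + b ≡ m₂ + a → ℤ.+ m₁ ℤ.- ℤ.+ m₂ ≡ ℤ.+ a ℤ.- ℤ.+ b
difference a b {m₁} {m₂} eq = begin
  ℤ.+ m₁ ℤ.- ℤ.+ m₂      ≡⟨ ℤ.m-n≡m⊖n m₁ m₂ ⟩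
  m₁ ℤ.⊖ m₂              ≡⟨ ℤ.+-cancelˡ-⊖ b m₁ m₂ ⟨
  (b + m₁) ℤ.⊖ (b + m₂)  ≡⟨ cong₂ ℤ._⊖_ (trans (+-comm b m₁) eq) (+-comm b m₂) ⟩
  (m₂ + a) ℤ.⊖ (m₂ + b)  ≡⟨ ℤ.+-cancelˡ-⊖ m₂ a b ⟩
  a ℤ.⊖ b                ≡⟨ ℤ.m-n≡m⊖n a b ⟨
  ℤ.+ a ℤ.- ℤ.+ b        ∎
  where open ≡-Reasoning

𝟙 : ∀ {P : Set a} → Dec P → ℕ
𝟙 P? = if does P? then 1 else 0

𝟙-cong : ∀ {P : Set a} {Q : Set b} (P? : Dec P) (Q? : Dec Q) →
         (P → Q) → (Q → P) → 𝟙 P? ≡ 𝟙 Q?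
𝟙-cong (yes p) (yes q) P⇒Q Q⇒P = refl
𝟙-cong (yes p) (no ¬q) P⇒Q Q⇒P = contradiction (P⇒Q p) ¬q
𝟙-cong (no ¬p) (yes q) P⇒Q Q⇒P = contradiction (Q⇒P q) ¬p
𝟙-cong (no ¬p) (no ¬q) P⇒Q Q⇒P = refl

module Counting {a} {A : Set a} (_≟_ : DecidableEquality A) where

  count : A → List A → ℕ
  count a as = ∑ℕ as (λ b → 𝟙 (a ≟ b))

  count-∉ : ∀ {a} as → a ∉ as → count a as ≡ 0
  count-∉     []       a∉ = refl
  count-∉ {a} (b ∷ as) a∉ with a ≟ b
  ... | yes a≡b = contradiction (here a≡b) a∉
  ... | no  _   = count-∉ as (a∉ ∘ there)

  -- Without repetitions a count is the indicator of membership. Membership enters through an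
  -- equivalent `P`, so that for the arcs leaving a node it can be an equation between nodes.
  count-unique : ∀ {as a} {P : Set} → Unique as → (a ∈ as → P) → (P → a ∈ as) →
                 (P? : Dec P) → count a as ≡ 𝟙 P?
  count-unique {as} _ ∈⇒P P⇒∈ (no ¬P) = count-∉ as (¬P ∘ ∈⇒P)
  count-unique {as} {a} u _ P⇒∈ (yes p) = go u (P⇒∈ p)
    where
    go : ∀ {as} → Unique as → a ∈ as → count a as ≡ 1
    go {b ∷ as} (b∉ ∷ u) a∈ with a ≟ b | a∈
    ... | yes refl | _          = cong suc (count-∉ as (λ a∈as → All.lookup b∉ a∈as refl))
    ... | no  a≢b  | here a≡b   = contradiction a≡b a≢b
    ... | no  _    | there a∈as = go u a∈as

  count≤1 : ∀ {as} → Unique as → ∀ a → count a as ≤ 1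
  count≤1 []                   a = z≤n
  count≤1 {b ∷ as} (b∉ ∷ u) a with a ≟ b
  ... | yes refl = s≤s (≤-reflexive (count-∉ as (λ a∈as → All.lookup b∉ a∈as refl)))
  ... | no  _    = count≤1 u a

  -- Both sides add up the weights of all pairs of equal entries of the two lists; in such a pair
  -- the weight may be read off either entry.
  double-count : ∀ as bs (g : A → ℕ) → ∑ℕ as (λ a → g a * count a bs) ≡
                             ∑ℕ bs (λ b → g b * count b as)
  double-count as bs g = begin
    ∑ℕ as (λ a → g a * count a bs)
      ≡⟨ ∑ℕ-cong as (λ {a} _ → *-distribˡ-∑ℕ (g a) bs _) ⟩
    ∑ℕ as (λ a → ∑ℕ bs (λ b → g a * 𝟙 (a ≟ b)))
      ≡⟨ ∑ℕ-swap as bs _ ⟩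
    ∑ℕ bs (λ b → ∑ℕ as (λ a → g a * 𝟙 (a ≟ b)))
      ≡⟨ ∑ℕ-cong bs (λ {b} _ → ∑ℕ-cong as (λ {a} _ → weight-sym a b)) ⟩
    ∑ℕ bs (λ b → ∑ℕ as (λ a → g b * 𝟙 (b ≟ a)))
      ≡⟨ ∑ℕ-cong bs (λ {b} _ → *-distribˡ-∑ℕ (g b) as _) ⟨
    ∑ℕ bs (λ b → g b * count b as) ∎
    where
    open ≡-Reasoning
    weight-sym : ∀ a b → g a * 𝟙 (a ≟ b) ≡ g b * 𝟙 (b ≟ a)
    weight-sym a b with a ≟ b | b ≟ a
    ... | yes refl | yes _   = refl
    ... | yes refl | no a≢a  = contradiction refl a≢a
    ... | no a≢a   | yes refl = contradiction refl a≢a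
    ... | no _     | no _    = trans (*-zeroʳ (g a)) (sym (*-zeroʳ (g b)))

module Fibres {b} {B : Set b} (_≟_ : DecidableEquality B) {a} {A : Set a} (φ : A → B) where

  -- The pushforward of `g` along `φ`. An indicator factor replaces filtering, so that the linearity
  -- of sums applies directly.
  fibreSum : List A → (A → ℕ) → B → ℕ
  fibreSum as g b = ∑ℕ as (λ a → 𝟙 (b ≟ φ a) * g a)

  fibreSum-mono : ∀ as g h b → (∀ {a} → a ∈ as → b ≡ φ a → g a ≤ h a) →
                  fibreSum as g b ≤ fibreSum as h b
  fibreSum-mono as g h b g≤h = ∑ℕ-mono as term
    where
    term : ∀ {a} → a ∈ as → 𝟙 (b ≟ φ a) * g a ≤ 𝟙 (b ≟ φ a) * h a
    term {a} a∈ with b ≟ φ a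
    ... | yes b≡φa = *-monoʳ-≤ 1 (g≤h a∈ b≡φa)
    ... | no  _    = z≤n

  *-fibreSum : ∀ m as g b → m * fibreSum as g b ≡ fibreSum as (λ a → m * g a) b
  *-fibreSum m as g b = trans (*-distribˡ-∑ℕ m as _)
    (∑ℕ-cong as (λ {a} _ → *-CS.x∙yz≈y∙xz m (𝟙 (b ≟ φ a)) (g a)))

  ∑ℕ-fibreSum : ∀ {k} {K : Set k} (ks : List K) as (g : K → A → ℕ) b →
                ∑ℕ ks (λ k → fibreSum as (g k) b) ≡
                fibreSum as (λ a → ∑ℕ ks (λ k → g k a)) b
  ∑ℕ-fibreSum ks as g b = trans (∑ℕ-swap ks as _)
    (∑ℕ-cong as (λ {a} _ → sym (*-distribˡ-∑ℕ (𝟙 (b ≟ φ a)) ks (λ k → g k a))))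

-- Finite sums of costs

module CostSums {c ℓ₁ ℓ₂} (C : OrderedAbelianGroup c ℓ₁ ℓ₂) where
  open OrderedAbelianGroup C
    using (Carrier; _≈_; _≤ᶜ_; 0#; ∑; _·_; isTotalOrder; abelianGroup)
    renaming (_+_ to infixl 6 _⊕_; +-monoˡ-≤ to ⊕-monoˡ-≤)
  private
    module G = AbelianGroup abelianGroup
    module ≤ᶜ = IsTotalOrder isTotalOrder
    module Mult = Algebra.Properties.Monoid.Mult G.monoid
    open import Algebra.Properties.CommutativeSemigroup G.commutativeSemigroup using (interchange)

  ≤ᶜ-poset : Poset c ℓ₁ ℓ₂
  ≤ᶜ-poset = record { isPartialOrder = ≤ᶜ.isPartialOrder }

  module ≤-Reasoningᶜ = Relation.Binary.Reasoning.PartialOrder ≤ᶜ-poset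

  ⊕-mono-≤ : ∀ {x y u v} → x ≤ᶜ y → u ≤ᶜ v → (x ⊕ u) ≤ᶜ (y ⊕ v)
  ⊕-mono-≤ {x} {y} {u} {v} x≤y u≤v = begin
    x ⊕ u ≤⟨ ⊕-monoˡ-≤ u x≤y ⟩
    y ⊕ u ≈⟨ G.comm y u ⟩
    u ⊕ y ≤⟨ ⊕-monoˡ-≤ y u≤v ⟩
    v ⊕ y ≈⟨ G.comm v y ⟩
    y ⊕ v ∎
    where open ≤-Reasoningᶜ

  ∑-cong : ∀ (as : List A) {g h} → (∀ {a} → a ∈ as → g a ≈ h a) → ∑ as g ≈ ∑ as h
  ∑-cong []       g≈h = G.refl
  ∑-cong (a ∷ as) g≈h = G.∙-cong (g≈h (here refl)) (∑-cong as (g≈h ∘ there))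

  ∑-mono : ∀ (as : List A) {g h} → (∀ {a} → a ∈ as → g a ≤ᶜ h a) → ∑ as g ≤ᶜ ∑ as h
  ∑-mono []       g≤h = ≤ᶜ.refl
  ∑-mono (a ∷ as) g≤h = ⊕-mono-≤ (g≤h (here refl)) (∑-mono as (g≤h ∘ there))

  ∑-zero : ∀ (as : List A) → ∑ as (λ _ → 0#) ≈ 0#
  ∑-zero []       = G.refl
  ∑-zero (a ∷ as) = G.trans (G.identityˡ _) (∑-zero as)

  ∑-⊕ : ∀ (as : List A) g h → ∑ as (λ a → g a ⊕ h a) ≈ ∑ as g ⊕ ∑ as h
  ∑-⊕ []       g h = G.sym (G.identityˡ 0#)
  ∑-⊕ (a ∷ as) g h = G.trans (G.∙-congˡ (∑-⊕ as g h)) (interchange _ _ _ _)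

  ∑-swap : ∀ (as : List A) (bs : List B) (g : A → B → Carrier) →
           ∑ as (λ a → ∑ bs (g a)) ≈ ∑ bs (λ b → ∑ as (λ a → g a b))
  ∑-swap []       bs g = G.sym (∑-zero bs)
  ∑-swap (a ∷ as) bs g = G.trans (G.∙-congˡ (∑-swap as bs g)) (G.sym (∑-⊕ bs (g a) _))

  ·-nonneg : ∀ m {w} → 0# ≤ᶜ w → 0# ≤ᶜ m · w
  ·-nonneg zero    0≤w = ≤ᶜ.refl
  ·-nonneg (suc m) 0≤w = ≤ᶜ.trans (≤ᶜ.reflexive (G.sym (G.identityˡ 0#)))
                                  (⊕-mono-≤ 0≤w (·-nonneg m 0≤w))

  ·-monoˡ-≤ : ∀ {m n w} → 0# ≤ᶜ w → m ≤ n → m · w ≤ᶜ n · w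
  ·-monoˡ-≤ {n = n} 0≤w z≤n       = ·-nonneg n 0≤w
  ·-monoˡ-≤         0≤w (s≤s m≤n) = ⊕-mono-≤ ≤ᶜ.refl (·-monoˡ-≤ 0≤w m≤n)

  module _ {b} {B : Set b} (_≟_ : DecidableEquality B) where

    ∑-𝟙 : ∀ {bs} → Unique bs → ∀ {b} → b ∈ bs → ∀ m (w : B → Carrier) →
          ∑ bs (λ b′ → (𝟙 (b′ ≟ b) * m) · w b′) ≈ m · w b
    ∑-𝟙 {b′ ∷ bs} (b′∉ ∷ u) {b} b∈ m w with b′ ≟ b | b∈
    ... | yes refl | _ = G.trans
      (G.∙-cong (Mult.×-congˡ (+-identityʳ m))
                (G.trans (∑-cong bs λ b″∈ → vanish (≢-sym (All.lookup b′∉ b″∈))) (∑-zero bs)))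
      (G.identityʳ _)
      where
      vanish : ∀ {b″} → b″ ≢ b → (𝟙 (b″ ≟ b) * m) · w b″ ≈ 0#
      vanish {b″} b″≢b with b″ ≟ b
      ... | yes b″≡b = contradiction b″≡b b″≢b
      ... | no  _    = G.refl
    ... | no b′≢b  | here b≡b′  = contradiction (sym b≡b′) b′≢b
    ... | no _     | there b∈bs = G.trans (G.identityˡ _) (∑-𝟙 u b∈bs m w)

    module _ {a} {A : Set a} (φ : A → B) where
      open Fibres _≟_ φ

      -- Change of variables along `φ`: each entry `a` contributes to the single index `φ a`, which
      -- occurs exactly once in `bs`.
      ∑-fibreSum : ∀ {as bs} → Unique bs → (∀ {a} → a ∈ as → φ a ∈ bs) →
                   ∀ (g : A → ℕ) (w : B → Carrier) →
                   ∑ bs (λ b → fibreSum as g b · w b) ≈ ∑ as (λ a → g a · w (φ a))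
      ∑-fibreSum {[]}     {bs} u φ∈ g w = ∑-zero bs
      ∑-fibreSum {a ∷ as} {bs} u φ∈ g w = begin
        ∑ bs (λ b → (𝟙 (b ≟ φ a) * g a + fibreSum as g b) · w b)
          ≈⟨ ∑-cong bs (λ {b} _ → Mult.×-homo-+ (w b) (𝟙 (b ≟ φ a) * g a) (fibreSum as g b)) ⟩
        ∑ bs (λ b → (𝟙 (b ≟ φ a) * g a) · w b ⊕ fibreSum as g b · w b)
          ≈⟨ ∑-⊕ bs (λ b → (𝟙 (b ≟ φ a) * g a) · w b) (λ b → fibreSum as g b · w b) ⟩
        ∑ bs (λ b → (𝟙 (b ≟ φ a) * g a) · w b) ⊕ ∑ bs (λ b → fibreSum as g b · w b)
          ≈⟨ G.∙-cong (∑-𝟙 u (φ∈ (here refl)) (g a) w) (∑-fibreSum {as} u (φ∈ ∘ there) g w) ⟩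
        g a · w (φ a) ⊕ ∑ as (λ a → g a · w (φ a)) ∎
        where open import Relation.Binary.Reasoning.Setoid G.setoid

      -- The form needed for both parts of the objective: raising `h` to the pushforward cannot
      -- lower the sum when the weights are nonnegative.
      ∑-fibreSum-≤ : ∀ {as bs} → Unique bs → (∀ {a} → a ∈ as → φ a ∈ bs) →
                     ∀ (h : B → ℕ) (g : A → ℕ) (w : B → Carrier) →
                     (∀ b → b ∈ bs → 0# ≤ᶜ w b) → (∀ b → h b ≤ fibreSum as g b) →
                     ∑ bs (λ b → h b · w b) ≤ᶜ ∑ as (λ a → g a · w (φ a))
      ∑-fibreSum-≤ {as} {bs} u φ∈ h g w 0≤w h≤g = ≤ᶜ.trans
        (∑-mono bs (λ {b} b∈ → ·-monoˡ-≤ (0≤w b b∈) (h≤g b)))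
        (≤ᶜ.reflexive (∑-fibreSum u φ∈ g w))

-- Comparison of optimal values

module _ {c ℓ₁ ℓ₂} {C : OrderedAbelianGroup c ℓ₁ ℓ₂} where
  open OrderedAbelianGroup C using (_≤ᶜ_; _≤⁺_; isTotalOrder)
  open MinimizationProgram

  -- If `Q` is infeasible its value is the top element. Otherwise an optimal solution of `Q` yields
  -- a solution of `P` that costs no more, so `P` cannot be infeasible.
  relaxation-≤ : ∀ (P Q : MinimizationProgram C) →
    (∀ s → Feasible Q s → ∃ λ s′ → Feasible P s′ × cost P s′ ≤ᶜ cost Q s) →
    ∀ {zP zQ} → IsOptimalValue C P zP → IsOptimalValue C Q zQ → zP ≤⁺ zQ
  relaxation-≤ P Q relax _                  (infeasible _) = _ ≤⊤⁺
  relaxation-≤ P Q relax (infeasible none)  (attained (s , feasible , _) _) =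
    let s′ , feasible′ , _ = relax s feasible in contradiction feasible′ (none s′)
  relaxation-≤ P Q relax (attained _ least) (attained (s , feasible , cost≈z) _) =
    let s′ , feasible′ , s′≤s = relax s feasible
    in [ ≤ᶜ.trans (least s′ feasible′) (≤ᶜ.trans s′≤s (≤ᶜ.reflexive cost≈z)) ]
    where module ≤ᶜ = IsTotalOrder isTotalOrder

-- Walks in timed networks

module _ {n : ℕ} where

  src tgt : TimedArc n → TimedNode n
  src (move p q) = p
  src (hold p q) = p
  tgt (move p q) = q
  tgt (hold p q) = q

  _≟ᴬ_ : DecidableEquality (TimedArc n)
  move p q ≟ᴬ move p′ q′ = map′ (λ { (refl , refl) → refl }) (λ { refl → refl , refl })
                                (p ≟ᵀ p′ ×-dec q ≟ᵀ q′)
  move p q ≟ᴬ hold p′ q′ = no λ ()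
  hold p q ≟ᴬ move p′ q′ = no λ ()
  hold p q ≟ᴬ hold p′ q′ = map′ (λ { (refl , refl) → refl }) (λ { refl → refl , refl })
                                (p ≟ᵀ p′ ×-dec q ≟ᵀ q′)

  _≟ᴹ_ : DecidableEquality (TimedNode n × TimedNode n)
  _≟ᴹ_ = ≡-dec _≟ᵀ_ _≟ᵀ_

  open Counting _≟ᴬ_ public

  -- Storage arcs weigh nothing, so sums of this one form express the transit time of a walk as well
  -- as its number of uses of a given movement arc.
  moveWeight : (TimedNode n × TimedNode n → ℕ) → TimedArc n → ℕ
  moveWeight g (move p q) = g (p , q)
  moveWeight g (hold p q) = 0

  -- The programs sum over all movement arcs, walks over their own arcs. Double counting relates the
  -- two, as each movement arc of `as` occurs exactly once in `ms`.
  ∑ℕ-moves : ∀ {ms as} g → Unique ms → (∀ {p q} → move p q ∈ as → (p , q) ∈ ms) →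
             ∑ℕ ms (λ m → g m * count (uncurry move m) as) ≡ ∑ℕ as (moveWeight g)
  ∑ℕ-moves {ms} {as} g u as⊆ms = begin
    ∑ℕ ms (λ m → g m * count (uncurry move m) as)
      ≡⟨ cong sum (map-∘ ms) ⟩
    ∑ℕ (map (uncurry move) ms) (λ a → moveWeight g a * count a as)
      ≡⟨ double-count (map (uncurry move) ms) as (moveWeight g) ⟩
    ∑ℕ as (λ a → moveWeight g a * count a (map (uncurry move) ms))
      ≡⟨ ∑ℕ-cong as multiplicity ⟩
    ∑ℕ as (moveWeight g) ∎
    where
    open ≡-Reasoning
    multiplicity : ∀ {a} → a ∈ as →
      moveWeight g a * count a (map (uncurry move) ms) ≡ moveWeight g a
    multiplicity {hold p q} a∈as = refl
    multiplicity {move p q} a∈as = trans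
      (cong (g (p , q) *_) (count-unique (Unique.map⁺ (λ { refl → refl }) u) (λ x → x)
        (λ x → x) (yes (∈ₚ.∈-map⁺ (uncurry move) (as⊆ms a∈as)))))
      (*-identityʳ _)

  data Link (N : TimedNetwork n) (p q : TimedNode n) : Set where
    moving  : TimedNetwork.Move N p q → Link N p q
    holding : TimedNetwork.Hold N p q → Link N p q

  Walk : TimedNetwork n → TimedNode n → TimedNode n → Set
  Walk N = Star (Link N)

  module _ {N : TimedNetwork n} where
    open TimedNetwork N using (HasArc)

    arc : ∀ {p q} → Link N p q → TimedArc n
    arc {p} {q} (moving _)  = move p q
    arc {p} {q} (holding _) = hold p q

    src-arc : ∀ {p q} (e : Link N p q) → src (arc e) ≡ p
    src-arc (moving _)  = refl
    src-arc (holding _) = refl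

    tgt-arc : ∀ {p q} (e : Link N p q) → tgt (arc e) ≡ q
    tgt-arc (moving _)  = refl
    tgt-arc (holding _) = refl

    hasArc : ∀ {p q} (e : Link N p q) → HasArc (arc e)
    hasArc (moving pq)  = pq
    hasArc (holding pq) = pq

    arcs : ∀ {p q} → Walk N p q → List (TimedArc n)
    arcs ε       = []
    arcs (e ◅ w) = arc e ∷ arcs w

    arcs-◅◅ : ∀ {p q r} (w : Walk N p q) (w′ : Walk N q r) →
              arcs (w ◅◅ w′) ≡ arcs w ++ arcs w′
    arcs-◅◅ ε       w′ = refl
    arcs-◅◅ (e ◅ w) w′ = cong (arc e ∷_) (arcs-◅◅ w w′)

    weight-◅◅ : ∀ g {p q r} (w : Walk N p q) (w′ : Walk N q r) →
                ∑ℕ (arcs (w ◅◅ w′)) (moveWeight g) ≡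
                ∑ℕ (arcs w) (moveWeight g) + ∑ℕ (arcs w′) (moveWeight g)
    weight-◅◅ g w w′ = trans (cong (λ as → ∑ℕ as (moveWeight g)) (arcs-◅◅ w w′))
                             (∑ℕ-++ (arcs w) (arcs w′) (moveWeight g))

    arcs-hasArc : ∀ {p q} (w : Walk N p q) {a} → a ∈ arcs w → HasArc a
    arcs-hasArc (e ◅ w) (here refl) = hasArc e
    arcs-hasArc (e ◅ w) (there a∈)  = arcs-hasArc w a∈

    -- The target of each link is the start of the remaining walk, so the contributions telescope
    -- and only the end points are left.
    departures-arrivals : ∀ {p q} (w : Walk N p q) x →
      ∑ℕ (arcs w) (λ a → 𝟙 (x ≟ᵀ src a)) + 𝟙 (x ≟ᵀ q) ≡
      ∑ℕ (arcs w) (λ a → 𝟙 (x ≟ᵀ tgt a)) + 𝟙 (x ≟ᵀ p)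
    departures-arrivals ε x = refl
    departures-arrivals {p} {q} (_◅_ {j = p′} e w) x
      rewrite src-arc e | tgt-arc e = begin
      𝟙 (x ≟ᵀ p) + out + 𝟙 (x ≟ᵀ q)    ≡⟨ +-assoc (𝟙 (x ≟ᵀ p)) out _ ⟩
      𝟙 (x ≟ᵀ p) + (out + 𝟙 (x ≟ᵀ q))  ≡⟨ cong (𝟙 (x ≟ᵀ p) +_) (departures-arrivals w x) ⟩
      𝟙 (x ≟ᵀ p) + (inn + 𝟙 (x ≟ᵀ p′)) ≡⟨ +-comm (𝟙 (x ≟ᵀ p)) _ ⟩
      inn + 𝟙 (x ≟ᵀ p′) + 𝟙 (x ≟ᵀ p)   ≡⟨ cong (_+ 𝟙 (x ≟ᵀ p)) (+-comm inn _) ⟩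
      𝟙 (x ≟ᵀ p′) + inn + 𝟙 (x ≟ᵀ p)   ∎
      where
      open ≡-Reasoning
      out = ∑ℕ (arcs w) (λ a → 𝟙 (x ≟ᵀ src a))
      inn = ∑ℕ (arcs w) (λ a → 𝟙 (x ≟ᵀ tgt a))

    suffix : ∀ {p p′ q} (w : Walk N p q) → p′ ∈ map src (arcs w) →
             ∃ λ (w′ : Walk N p′ q) → arcs w′ ⊆ arcs w
    suffix (e ◅ w) (here refl) rewrite src-arc e = e ◅ w , ⊆-refl
    suffix (e ◅ w) (there p∈)  =
      let w′ , w′⊆w = suffix w p∈ in w′ , arc e ∷ʳ w′⊆w

    -- Only sources are compared, so the final node may also be visited earlier. Distinct sources
    -- already make the arcs distinct, which is what a binary flow requires.
    Simple : ∀ {p q} → Walk N p q → Set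
    Simple w = Unique (map src (arcs w))

    simple⇒unique : ∀ {p q} (w : Walk N p q) → Simple w → Unique (arcs w)
    simple⇒unique w = Unique.map⁻

    -- Loops are erased from the end: if the first node recurs as a source in the simple remainder,
    -- the part of the remainder from that visit on replaces the whole walk.
    eraseLoops : ∀ {p q} (w : Walk N p q) →
                 ∃ λ (w′ : Walk N p q) → arcs w′ ⊆ arcs w × Simple w′
    eraseLoops ε = ε , [] , []
    eraseLoops {p} (e ◅ w) with eraseLoops w
    ... | w₁ , w₁⊆w , simple with p ∈? map src (arcs w₁)
      where open import Data.List.Membership.DecPropositional _≟ᵀ_ using (_∈?_)
    ... | yes p∈ = let w₂ , w₂⊆w₁ = suffix w₁ p∈ in
      w₂ , arc e ∷ʳ ⊆-trans w₂⊆w₁ w₁⊆w ,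
      Unique-resp-⊆ (⊆ₚ.map⁺ src w₂⊆w₁) simple
    ... | no  p∉ = e ◅ w₁ , refl ∷ w₁⊆w ,
      All.tabulate (λ {x} x∈ e≡x →
        p∉ (subst (_∈ map src (arcs w₁)) (trans (sym e≡x) (src-arc e)) x∈)) ∷ simple

-- Flows in the time-expanded network and their rounding

module _ {c ℓ₁ ℓ₂} (C : OrderedAbelianGroup c ℓ₁ ℓ₂) (I : Instance C) where
  open Instance I

  private
    nodes : List (TimedNode n)
    nodes = timedNodes C I

  ∈-timedNodes⁺ : ∀ {v t} → t ≤ T → (v , t) ∈ nodes
  ∈-timedNodes⁺ {v} t≤T = ∈ₚ.∈-cartesianProduct⁺ (∈ₚ.∈-allFin v) (∈ₚ.∈-upTo⁺ (s≤s t≤T))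

  timedNodes-unique : Unique nodes
  timedNodes-unique = Unique.cartesianProduct⁺ (Unique.allFin⁺ n) (Unique.upTo⁺ (suc T))

  module _ (N : TimedNetwork n) where
    open TimedNetwork N

    moves-unique : Unique (moves C I N)
    moves-unique = Unique.filter⁺ (uncurry Move?)
      (Unique.cartesianProduct⁺ timedNodes-unique timedNodes-unique)

    ∈-moves⁺ : ∀ {p q} → p ∈ nodes → q ∈ nodes → Move p q → (p , q) ∈ moves C I N
    ∈-moves⁺ p∈ q∈ = ∈ₚ.∈-filter⁺ (uncurry Move?) (∈ₚ.∈-cartesianProduct⁺ p∈ q∈)

    ∈-moves⁻ : ∀ {p q} → (p , q) ∈ moves C I N → Move p q
    ∈-moves⁻ pq∈ = proj₂ (∈ₚ.∈-filter⁻ (uncurry Move?) {xs = cartesianProduct nodes nodes} pq∈)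

    ∈-δ⁺⁺ : ∀ {a} → HasArc a → tgt a ∈ nodes → a ∈ δ⁺ C I N (src a)
    ∈-δ⁺⁺ {move p q} pq q∈ = ∈ₚ.∈-++⁺ˡ (∈ₚ.∈-map⁺ (move p) (∈ₚ.∈-filter⁺ (Move? p) q∈ pq))
    ∈-δ⁺⁺ {hold p q} pq q∈ = ∈ₚ.∈-++⁺ʳ _ (∈ₚ.∈-map⁺ (hold p) (∈ₚ.∈-filter⁺ (Hold? p) q∈ pq))

    ∈-δ⁻⁺ : ∀ {a} → HasArc a → src a ∈ nodes → a ∈ δ⁻ C I N (tgt a)
    ∈-δ⁻⁺ {move p q} pq p∈ = ∈ₚ.∈-++⁺ˡ
      (∈ₚ.∈-map⁺ (λ p → move p q) (∈ₚ.∈-filter⁺ (λ p → Move? p q) p∈ pq))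
    ∈-δ⁻⁺ {hold p q} pq p∈ = ∈ₚ.∈-++⁺ʳ _
      (∈ₚ.∈-map⁺ (λ p → hold p q) (∈ₚ.∈-filter⁺ (λ p → Hold? p q) p∈ pq))

    δ⁺⇒link : ∀ {p a} → a ∈ δ⁺ C I N p → ∃ λ q → ∃ λ (e : Link N p q) → arc e ≡ a
    δ⁺⇒link {p} a∈ with ∈ₚ.∈-++⁻ (map (move p) (filter (Move? p) nodes)) a∈
    ... | inj₁ a∈m with q , q∈ , refl ← ∈ₚ.∈-map⁻ (move p) a∈m =
      q , moving (proj₂ (∈ₚ.∈-filter⁻ (Move? p) {xs = nodes} q∈)) , refl
    ... | inj₂ a∈h with q , q∈ , refl ← ∈ₚ.∈-map⁻ (hold p) a∈h =
      q , holding (proj₂ (∈ₚ.∈-filter⁻ (Hold? p) {xs = nodes} q∈)) , refl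

    src-δ⁺ : ∀ {p a} → a ∈ δ⁺ C I N p → p ≡ src a
    src-δ⁺ a∈ with _ , e , refl ← δ⁺⇒link a∈ = sym (src-arc e)

    tgt-δ⁻ : ∀ {q a} → a ∈ δ⁻ C I N q → q ≡ tgt a
    tgt-δ⁻ {q} a∈
      with ∈ₚ.∈-++⁻ (map (λ p → move p q) (filter (λ p → Move? p q) nodes)) a∈
    ... | inj₁ a∈m with _ , _ , refl ← ∈ₚ.∈-map⁻ (λ p → move p q) a∈m = refl
    ... | inj₂ a∈h with _ , _ , refl ← ∈ₚ.∈-map⁻ (λ p → hold p q) a∈h = refl

    δ⁺-unique : ∀ p → Unique (δ⁺ C I N p)
    δ⁺-unique p = Unique.++⁺
      (Unique.map⁺ (λ { refl → refl }) (Unique.filter⁺ (Move? p) timedNodes-unique))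
      (Unique.map⁺ (λ { refl → refl }) (Unique.filter⁺ (Hold? p) timedNodes-unique))
      disjoint
      where
      disjoint : ∀ {a} → ¬ (a ∈ map (move p) (filter (Move? p) nodes) ×
                            a ∈ map (hold p) (filter (Hold? p) nodes))
      disjoint (m , h) with _ , _ , refl ← ∈ₚ.∈-map⁻ (move p) m
                       with _ , _ , ()   ← ∈ₚ.∈-map⁻ (hold p) h

    δ⁻-unique : ∀ q → Unique (δ⁻ C I N q)
    δ⁻-unique q = Unique.++⁺
      (Unique.map⁺ (λ { refl → refl }) (Unique.filter⁺ (λ p → Move? p q) timedNodes-unique))
      (Unique.map⁺ (λ { refl → refl }) (Unique.filter⁺ (λ p → Hold? p q) timedNodes-unique))
      disjoint
      where
      disjoint : ∀ {a} → ¬ (a ∈ map (λ p → move p q) (filter (λ p → Move? p q) nodes) ×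
                            a ∈ map (λ p → hold p q) (filter (λ p → Hold? p q) nodes))
      disjoint (m , h) with _ , _ , refl ← ∈ₚ.∈-map⁻ (λ p → move p q) m
                       with _ , _ , ()   ← ∈ₚ.∈-map⁻ (λ p → hold p q) h

    -- The sums of the programs run through the list `nodes`; this condition ensures that they miss
    -- no arc of a walk.
    Bounded : Set
    Bounded = ∀ a → HasArc a → src a ∈ nodes × tgt a ∈ nodes

    module _ (bounded : Bounded) {p q} (w : Walk N p q) where

      private
        count₁ : ∀ as → ∑ℕ as (λ a → count a (arcs w)) ≡ ∑ℕ (arcs w) (λ b → count b as)
        count₁ as = begin
          ∑ℕ as (λ a → count a (arcs w))
            ≡⟨ ∑ℕ-cong as (λ _ → *-identityˡ _) ⟨
          ∑ℕ as (λ a → 1 * count a (arcs w))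
            ≡⟨ double-count as (arcs w) (λ _ → 1) ⟩
          ∑ℕ (arcs w) (λ b → 1 * count b as)
            ≡⟨ ∑ℕ-cong (arcs w) (λ _ → *-identityˡ _) ⟩
          ∑ℕ (arcs w) (λ b → count b as) ∎
          where open ≡-Reasoning

      -- By double counting the sum runs over the arcs of the walk instead; such an arc is listed
      -- once at `x` if it leaves `x`, and otherwise not at all.
      walk-outflow : ∀ x → ∑ℕ (δ⁺ C I N x) (λ a → count a (arcs w)) ≡
                           ∑ℕ (arcs w) (λ a → 𝟙 (x ≟ᵀ src a))
      walk-outflow x = trans (count₁ (δ⁺ C I N x)) (∑ℕ-cong (arcs w) λ {a} a∈ →
        count-unique {a = a} (δ⁺-unique x) src-δ⁺
          (λ { refl → ∈-δ⁺⁺ (arcs-hasArc w a∈) (proj₂ (bounded a (arcs-hasArc w a∈))) })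
          (x ≟ᵀ src a))

      walk-inflow : ∀ x → ∑ℕ (δ⁻ C I N x) (λ a → count a (arcs w)) ≡
                          ∑ℕ (arcs w) (λ a → 𝟙 (x ≟ᵀ tgt a))
      walk-inflow x = trans (count₁ (δ⁻ C I N x)) (∑ℕ-cong (arcs w) λ {a} a∈ →
        count-unique {a = a} (δ⁻-unique x) tgt-δ⁻
          (λ { refl → ∈-δ⁻⁺ (arcs-hasArc w a∈) (proj₁ (bounded a (arcs-hasArc w a∈))) })
          (x ≟ᵀ tgt a))

      -- Moving p and q to the opposite sides avoids subtraction.
      walk-conservation : ∀ x →
        ∑ℕ (δ⁺ C I N x) (λ a → count a (arcs w)) + 𝟙 (x ≟ᵀ q) ≡
        ∑ℕ (δ⁻ C I N x) (λ a → count a (arcs w)) + 𝟙 (x ≟ᵀ p)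
      walk-conservation x = begin
        ∑ℕ (δ⁺ C I N x) (λ a → count a (arcs w)) + 𝟙 (x ≟ᵀ q)
          ≡⟨ cong (_+ 𝟙 (x ≟ᵀ q)) (walk-outflow x) ⟩
        ∑ℕ (arcs w) (λ a → 𝟙 (x ≟ᵀ src a)) + 𝟙 (x ≟ᵀ q)
          ≡⟨ departures-arrivals w x ⟩
        ∑ℕ (arcs w) (λ a → 𝟙 (x ≟ᵀ tgt a)) + 𝟙 (x ≟ᵀ p)
          ≡⟨ cong (_+ 𝟙 (x ≟ᵀ p)) (walk-inflow x) ⟨
        ∑ℕ (δ⁻ C I N x) (λ a → count a (arcs w)) + 𝟙 (x ≟ᵀ p) ∎
        where open ≡-Reasoning

  private
    origin dest : Commodity → TimedNode n
    origin k = o k , r k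
    dest   k = d k , l k

  balance-origin : ∀ k → balance C I k (origin k) ≡ 1ℤ
  balance-origin k rewrite dec-true (origin k ≟ᵀ origin k) refl = refl

  balance-transit : ∀ k {p} → p ≢ origin k → p ≢ dest k → balance C I k p ≡ 0ℤ
  balance-transit k {p} p≢o p≢d
    rewrite dec-false (p ≟ᵀ origin k) p≢o | dec-false (p ≟ᵀ dest k) p≢d = refl

  -- At a node that is both origin and destination `balance` would demand a surplus of 1, while a
  -- closed walk has none; distinct ends exclude this.
  unit-balance : ∀ k → origin k ≢ dest k → ∀ p {m₁ m₂} →
    m₁ + 𝟙 (p ≟ᵀ dest k) ≡ m₂ + 𝟙 (p ≟ᵀ origin k) →
    ℤ.+ m₁ ℤ.- ℤ.+ m₂ ≡ balance C I k p
  unit-balance k o≢d p eq with p ≟ᵀ origin k | p ≟ᵀ dest k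
  ... | yes refl | yes o≡d = contradiction o≡d o≢d
  ... | yes _    | no  _   = difference 1 0 eq
  ... | no  _    | yes _   = difference 0 1 eq
  ... | no  _    | no  _   = difference 0 0 eq

  transitTime : TimedNode n × TimedNode n → ℕ
  transitTime ((v , _) , (w , _)) = τ v w

  timeExpanded-bounded : ∀ G → Bounded (timeExpanded C I G)
  timeExpanded-bounded G (move (v , t) (w , _)) (_ , refl , t+τ≤T) =
    ∈-timedNodes⁺ (m+n≤o⇒m≤o t t+τ≤T) , ∈-timedNodes⁺ t+τ≤T
  timeExpanded-bounded G (hold (v , t) (w , _)) (_ , refl , refl , t<T) =
    ∈-timedNodes⁺ (<⇒≤ t<T) , ∈-timedNodes⁺ t<T

  module _ {G : Digraph n} (G⊆D : G ⊆ᴳ D) where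

    private
      N : TimedNetwork n
      N = timeExpanded C I G

    link-node : ∀ {p q} → Link N p q → TimedNetwork.Node N q
    link-node (moving (vw , refl , t+τ≤T))      = proj₂ (Digraph.incident G vw) , t+τ≤T
    link-node (holding (v∈G , refl , refl , t<T)) = v∈G , t<T

    link-later : ∀ {p q} → Link N p q → proj₂ p < proj₂ q
    link-later {v , t} (moving (vw , refl , _))    = m<m+n t (τ-pos (_⊆ᴳ_.arcs G⊆D vw))
    link-later         (holding (_ , _ , refl , _)) = ≤-refl

    -- A movement arc takes exactly its transit time, and a storage arc only adds to the elapsed
    -- time. The start time stands on the left to avoid subtraction.
    walk-duration : ∀ {p q} (w : Walk N p q) →
                    ∑ℕ (arcs w) (moveWeight transitTime) + proj₂ p ≤ proj₂ q
    walk-duration ε = ≤-refl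
    walk-duration {v , t} (_◅_ {j = j} e w) = begin
      moveWeight transitTime (arc e) + rest + t   ≡⟨ cong (_+ t) (+-comm _ rest) ⟩
      rest + moveWeight transitTime (arc e) + t   ≡⟨ +-assoc rest _ t ⟩
      rest + (moveWeight transitTime (arc e) + t) ≤⟨ +-monoʳ-≤ rest (link-duration e) ⟩
      rest + proj₂ j                              ≤⟨ walk-duration w ⟩
      _                                           ∎
      where
      open ≤-Reasoning
      rest = ∑ℕ (arcs w) (moveWeight transitTime)
      link-duration : ∀ {p q} (e : Link N p q) →
                      moveWeight transitTime (arc e) + proj₂ p ≤ proj₂ q
      link-duration {v , t} {w , _} (moving (_ , refl , _)) = ≤-reflexive (+-comm (τ v w) t)
      link-duration e@(holding _) = <⇒≤ (link-later e)

  -- Extracting a path from a flow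

  module _ {s : Solution C I}
           (feasible : IsFlowDesign C I (D-T C I) (D-Tᵏ C I) s) (k : Commodity) where
    open Solution s
    open IsFlowDesign feasible

    private
      N : TimedNetwork n
      N = D-Tᵏ C I k
      open TimedNetwork N using (Node)

      outflow inflow : TimedNode n → ℕ
      outflow p = ∑ℕ (δ⁺ C I N p) (x k)
      inflow  p = ∑ℕ (δ⁻ C I N p) (x k)

    -- Used with `b` equal to 1 at the origin and to 0 at transit nodes: flow leaves the origin, and
    -- whatever enters a transit node leaves it again.
    outflow≡ : ∀ {p b} → Node p → balance C I k p ≡ ℤ.+ b → outflow p ≡ b + inflow p
    outflow≡ {p} {b} p∈N bal = ℤ.+-injective (trans
      (sym (ℤ-+.//-rightDividesˡ (ℤ.+ inflow p) (ℤ.+ outflow p)))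
      (cong (ℤ._+ (ℤ.+ inflow p)) (trans (conservation k p p∈N) bal)))

    -- Some outgoing arc carries flow, and the same arc is a term of the inflow at its target.
    advance : ∀ {p} → 0 < outflow p →
              ∃ λ q → ∃ λ (e : Link N p q) → 0 < x k (arc e) × 0 < inflow q
    advance {p} 0<out with ∑ℕ-positive (δ⁺ C I N p) 0<out
    ... | a , a∈ , 0<xa with q , e , refl ← δ⁺⇒link N a∈ =
      q , e , 0<xa , <-≤-trans 0<xa (∈⇒≤∑ℕ (x k) (subst (λ q → arc e ∈ δ⁻ C I N q) (tgt-arc e)
        (∈-δ⁻⁺ N (hasArc e) (proj₁ (timeExpanded-bounded (Dᵏ k) (arc e) (hasArc e))))))

    -- Every link of the time-expanded network moves forward in time, so a used
    -- link can be followed to a used link until the destination is reached.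
    follow : ∀ fuel {v t} → T < t + fuel → r k < t → Node (v , t) → 0 < inflow (v , t) →
             ∃ λ (w : Walk N (v , t) (dest k)) → All (λ a → 0 < x k a) (arcs w)
    follow zero {v} {t} T<t _ (_ , t≤T) _ =
      contradiction (subst (T <_) (+-identityʳ t) T<t) (≤⇒≯ t≤T)
    follow (suc fuel) {v} {t} T<t+1+fuel r<t p∈N 0<in with (v , t) ≟ᵀ dest k
    ... | yes refl = ε , []
    ... | no p≢d =
      let bal = balance-transit k (λ p≡o → <⇒≢ r<t (sym (cong proj₂ p≡o))) p≢d
          (w , t′) , e , 0<xe , 0<in′ = advance (subst (0 <_) (sym (outflow≡ p∈N bal)) 0<in)
          t<t′ = link-later (Dᵏ⊆D k) e
          -- Each link advances time by at least 1, which makes up for the unit of fuel spent.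
          T<t′+fuel = <-≤-trans T<t+1+fuel
            (≤-trans (≤-reflexive (+-suc t fuel)) (+-monoˡ-≤ fuel t<t′))
          walk , used = follow fuel T<t′+fuel (<-trans r<t t<t′) (link-node (Dᵏ⊆D k) e) 0<in′
      in e ◅ walk , 0<xe ∷ used

    -- The balance at the origin is 1 even if origin and destination coincide, so the walk has a
    -- first link, and this link makes the release strictly precede the deadline.
    flow-walk : r k ≤ T → r k < l k ×
                ∃ λ (w : Walk N (origin k) (dest k)) → All (λ a → 0 < x k a) (arcs w)
    flow-walk r≤T =
      let 0<out = subst (0 <_) (sym (outflow≡ (o∈Dᵏ k , r≤T) (balance-origin k))) (s≤s z≤n)
          (v , t) , e , 0<xe , 0<in = advance 0<out
          r<t = link-later (Dᵏ⊆D k) e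
          walk , used = follow (suc T) (m≤n+m (suc T) t) r<t (link-node (Dᵏ⊆D k) e) 0<in
      in <-≤-trans r<t (m+n≤o⇒n≤o _ (walk-duration (Dᵏ⊆D k) walk)) , e ◅ walk , 0<xe ∷ used

    -- An arc of the path occurs once and carries at least one unit of flow. Walks forward in time
    -- have no loops; `eraseLoops` serves here to certify that the arcs are distinct.
    flow-path : r k ≤ T → ∃ λ (w : Walk N (origin k) (dest k)) →
                ∀ a → count a (arcs w) ≤ x k a
    flow-path r≤T =
      let _ , w , used = flow-walk r≤T
          w′ , w′⊆w , simple = eraseLoops w
      in w′ , λ a → bound (simple⇒unique w′ simple) (⊆ₚ.All-resp-⊆ w′⊆w used) a
      where
      bound : ∀ {as} → Unique as → All (λ a → 0 < x k a) as → ∀ a → count a as ≤ x k a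
      bound {as} u used a with x k a in eq
      ... | zero  = ≤-reflexive (count-∉ as λ a∈ →
                      contradiction (All.lookup used a∈) (subst (λ m → ¬ 0 < m) (sym eq) λ ()))
      ... | suc _ = ≤-trans (count≤1 u a) (s≤s z≤n)

  -- Rounding times down to the partial network

  module _ (S : PartialNetwork C I) where
    open PartialNetwork S

    restricted-bounded : ∀ G → Bounded (D-S restrictedTo G)
    restricted-bounded G (move p q) (pq , _) =
      let p∈ , q∈ = incidentˢ pq in
      ∈-timedNodes⁺ (proj₂ (nodeˢ p∈)) , ∈-timedNodes⁺ (proj₂ (nodeˢ q∈))
    restricted-bounded G (hold p q) ((p∈ , refl , (_ , q∈) , _) , _) =
      ∈-timedNodes⁺ (proj₂ (nodeˢ p∈)) , ∈-timedNodes⁺ (proj₂ (nodeˢ q∈))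

    -- The latest copy of v in N_S no later than t (the value 0 is junk if there
    -- is none, which (P1) excludes).
    round : Fin n → ℕ → ℕ
    round v zero    = zero
    round v (suc t) with Nodeˢ? (v , suc t)
    ... | yes _ = suc t
    ... | no  _ = round v t

    round-≤ : ∀ v t → round v t ≤ t
    round-≤ v zero    = z≤n
    round-≤ v (suc t) with Nodeˢ? (v , suc t)
    ... | yes _ = ≤-refl
    ... | no  _ = m≤n⇒m≤1+n (round-≤ v t)

    round-max : ∀ {v s t} → Nodeˢ (v , s) → s ≤ t → s ≤ round v t
    round-max {v} {_} {zero}  vs s≤t = s≤t
    round-max {v} {s} {suc t} vs s≤1+t with Nodeˢ? (v , suc t) | m≤n⇒m<n∨m≡n s≤1+t
    ... | yes _  | _               = s≤1+t
    ... | no _   | inj₁ (s≤s s≤t)  = round-max vs s≤t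
    ... | no ¬vt | inj₂ refl       = contradiction vs ¬vt

    round-fixed : ∀ {v t} → Nodeˢ (v , t) → round v t ≡ t
    round-fixed {v} {t} vt = ≤-antisym (round-≤ v t) (round-max vt ≤-refl)

    roundNode : TimedNode n → TimedNode n
    roundNode (v , t) = v , round v t

    -- The arrival time round w (round v t + τ v w) is the one of (P2).
    roundMove : TimedNode n × TimedNode n → TimedNode n × TimedNode n
    roundMove ((v , t) , (w , _)) = roundNode (v , t) , roundNode (w , round v t + τ v w)

    module _ (p1 : P1 C I S) (p2 : P2 C I S) where

      -- The downward search ends at time 0 at the latest, where (P1) provides a copy of `v`.
      round-node : ∀ {v} → Vertex v → ∀ t → Nodeˢ (v , round v t)
      round-node {v} v∈D zero    = P1.start p1 v v∈D
      round-node {v} v∈D (suc t) with Nodeˢ? (v , suc t)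
      ... | yes vt = vt
      ... | no  _  = round-node v∈D t

      -- Departing earlier keeps the arrival within the horizon, so (P2) applies at the rounded
      -- departure. Its arrival time and the rounded one are both maximal, hence equal.
      roundMove-moveˢ : ∀ {p q} → TimedNetwork.Move (D-T C I) p q →
                        uncurry Moveˢ (roundMove (p , q))
      roundMove-moveˢ {v , t} {w , _} (vw , refl , t+τ≤T)
        with t′ , ((t′≤ , wt′) , t′-max) , move∈S ←
               p2 vw (round-node (proj₁ (incident vw)) t)
                     (≤-trans (+-monoˡ-≤ (τ v w) (round-≤ v t)) t+τ≤T) =
        let arrival = round v t + τ v w in
        subst (λ s → Moveˢ (v , round v t) (w , s))
          (≤-antisym (round-max wt′ t′≤)
            (t′-max (round-≤ w arrival , round-node (proj₂ (incident vw)) arrival)))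
          move∈S

      roundMove-moves : ∀ {m} → m ∈ moves C I (D-T C I) → roundMove m ∈ moves C I D-S
      roundMove-moves {p , q} m∈ =
        let pq = roundMove-moveˢ (∈-moves⁻ (D-T C I) m∈)
            p∈ , q∈ = incidentˢ pq
        in ∈-moves⁺ D-S (∈-timedNodes⁺ (proj₂ (nodeˢ p∈)))
                                (∈-timedNodes⁺ (proj₂ (nodeˢ q∈))) pq

      module _ {G : Digraph n} (G⊆D : G ⊆ᴳ D) where
        private
          N Nᴳ : TimedNetwork n
          N  = timeExpanded C I G
          Nᴳ = D-S restrictedTo G
          module G = Digraph G
          open _⊆ᴳ_ G⊆D using (vertices) renaming (arcs to arcsᴳ)

        -- Either the rounded time is unchanged, or a copy exists at `suc t`. By `round-max` no copy
        -- lies strictly between, so a single storage arc leads there.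
        tick : ∀ {v} → G.Vertex v → ∀ t → Walk Nᴳ (v , round v t) (v , round v (suc t))
        tick {v} v∈G t with Nodeˢ? (v , suc t)
        ... | no  _  = ε
        ... | yes vt = holding ((round-node (vertices v∈G) t , refl ,
          (s≤s (round-≤ v t) , vt) , λ (round<i , vi) → ≰⇒> λ i≤t →
            <⇒≱ round<i (round-max vi i≤t)) , v∈G) ◅ ε

        tick-weight : ∀ g {v} (v∈G : G.Vertex v) t →
                      ∑ℕ (arcs (tick v∈G t)) (moveWeight g) ≡ 0
        tick-weight g {v} v∈G t with Nodeˢ? (v , suc t)
        ... | no  _ = refl
        ... | yes _ = refl

        -- The relation `≤′` is built by raising its upper end, one `tick` for each step.
        wait : ∀ {v} → G.Vertex v → ∀ {s t} → s ≤′ t → Walk Nᴳ (v , round v s) (v , round v t)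
        wait v∈G (≤′-reflexive refl)      = ε
        wait v∈G (≤′-step {n = t} s≤t) = wait v∈G s≤t ◅◅ tick v∈G t

        wait-weight : ∀ g {v} (v∈G : G.Vertex v) {s t} (s≤t : s ≤′ t) →
                      ∑ℕ (arcs (wait v∈G s≤t)) (moveWeight g) ≡ 0
        wait-weight g v∈G (≤′-reflexive refl) = refl
        wait-weight g v∈G (≤′-step {n = t} s≤t) = trans
          (weight-◅◅ g (wait v∈G s≤t) (tick v∈G t))
          (cong₂ _+_ (wait-weight g v∈G s≤t) (tick-weight g v∈G t))

        -- The rounded movement arc departs no later than the original, so it may arrive before the
        -- rounding of the original arrival; waiting fills the gap.
        roundLink : ∀ {p q} → Link N p q → Walk Nᴳ (roundNode p) (roundNode q)
        roundLink {v , t} {w , _} (moving (vw , refl , t+τ≤T)) =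
          moving (roundMove-moveˢ (arcsᴳ vw , refl , t+τ≤T) , vw) ◅
          wait (proj₂ (G.incident vw)) (≤⇒≤′ (+-monoˡ-≤ (τ v w) (round-≤ v t)))
        roundLink {v , t} (holding (v∈G , refl , refl , _)) = tick v∈G t

        roundLink-weight : ∀ g {p q} (e : Link N p q) →
          ∑ℕ (arcs (roundLink e)) (moveWeight g) ≡ moveWeight (g ∘ roundMove) (arc e)
        roundLink-weight g {v , t} {w , _} (moving (vw , refl , _)) = trans
          (cong (g _ +_) (wait-weight g (proj₂ (G.incident vw))
            (≤⇒≤′ (+-monoˡ-≤ (τ v w) (round-≤ v t)))))
          (+-identityʳ _)
        roundLink-weight g {v , t} (holding (v∈G , refl , refl , _)) = tick-weight g v∈G t

        roundWalk : ∀ {p q} → Walk N p q → Walk Nᴳ (roundNode p) (roundNode q)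
        roundWalk = kleisliStar roundNode roundLink

        roundWalk-weight : ∀ g {p q} (w : Walk N p q) →
          ∑ℕ (arcs (roundWalk w)) (moveWeight g) ≡ ∑ℕ (arcs w) (moveWeight (g ∘ roundMove))
        roundWalk-weight g ε       = refl
        roundWalk-weight g (e ◅ w) = trans (weight-◅◅ g (roundLink e) (roundWalk w))
          (cong₂ _+_ (roundLink-weight g e) (roundWalk-weight g w))

      -- The rounded solution and its feasibility

      module _ {s : Solution C I}
               (feasible : IsFlowDesign C I (D-T C I) (D-Tᵏ C I) s) where
        open Solution s
        open IsFlowDesign feasible using (capacity)
        open Fibres _≟ᴹ_ roundMove

        private
          movesᵀ = moves C I (D-T C I)

          r≤T : ∀ k → r k ≤ T
          r≤T k = proj₂ (nodeˢ (P1.origin p1 k))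

          path : ∀ k → Walk (D-Tᵏ C I k) (origin k) (dest k)
          path k = proj₁ (flow-path feasible k (r≤T k))

        -- One bound for all weights: transit times give the duration constraint, the indicator of
        -- an arc gives the flow bound. The end points are parameters so that they can be
        -- transported.
        Routing : (k : Commodity) (p q : TimedNode n) → Set
        Routing k p q = ∃ λ (w : Walk (D-Sᵏ k) p q) → Simple w ×
          (∀ g → ∑ℕ (arcs w) (moveWeight g) ≤ ∑ℕ (arcs (path k)) (moveWeight (g ∘ roundMove)))

        routing : ∀ k → Routing k (origin k) (dest k)
        routing k =
          let w = roundWalk (Dᵏ⊆D k) (path k)
              w′ , w′⊆w , simple = eraseLoops w
          -- By (P1) both ends are nodes of `D-S`, and rounding fixes such nodes.
          in subst₂ (Routing k)
               (cong (o k ,_) (round-fixed (P1.origin p1 k)))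
               (cong (d k ,_) (round-fixed (P1.destination p1 k)))
               (w′ , simple , λ g → ≤-trans (∑ℕ-⊆ w′⊆w (moveWeight g))
                 (≤-reflexive (roundWalk-weight (Dᵏ⊆D k) g (path k))))

        route : ∀ k → Walk (D-Sᵏ k) (origin k) (dest k)
        route k = proj₁ (routing k)

        roundSolution : Solution C I
        roundSolution = record
          { x = λ k a → count a (arcs (route k))
          ; y = λ p q → fibreSum movesᵀ (uncurry y) (p , q)
          }

        -- With the indicator of `b` as weight, the route uses `b` at most as often as the path uses
        -- arcs rounded to `b`, and the path lies below `x k`.
        flow-bound : ∀ k b → count (uncurry move b) (arcs (route k)) ≤
                             fibreSum movesᵀ (λ a → x k (uncurry move a)) b
        flow-bound k b = begin
          count (uncurry move b) (arcs (route k))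
            ≡⟨ ∑ℕ-cong (arcs (route k)) (λ {a} _ → indicator a) ⟩
          ∑ℕ (arcs (route k)) (moveWeight (λ c → 𝟙 (b ≟ᴹ c)))
            ≤⟨ proj₂ (proj₂ (routing k)) (λ c → 𝟙 (b ≟ᴹ c)) ⟩
          ∑ℕ (arcs (path k)) (moveWeight (λ a → 𝟙 (b ≟ᴹ roundMove a)))
            ≡⟨ ∑ℕ-moves (λ a → 𝟙 (b ≟ᴹ roundMove a)) (moves-unique (D-T C I)) path⊆moves ⟨
          fibreSum movesᵀ (λ a → count (uncurry move a) (arcs (path k))) b
            ≤⟨ fibreSum-mono movesᵀ (λ a → count (uncurry move a) (arcs (path k)))
                 (λ a → x k (uncurry move a)) b
                 (λ {a} _ _ → proj₂ (flow-path feasible k (r≤T k)) (uncurry move a)) ⟩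
          fibreSum movesᵀ (λ a → x k (uncurry move a)) b ∎
          where
          open ≤-Reasoning
          indicator : ∀ a → 𝟙 (uncurry move b ≟ᴬ a) ≡ moveWeight (λ c → 𝟙 (b ≟ᴹ c)) a
          indicator (move p q) = 𝟙-cong (uncurry move b ≟ᴬ move p q) (b ≟ᴹ (p , q))
            (λ { refl → refl }) (λ { refl → refl })
          indicator (hold p q) = refl
          path⊆moves : ∀ {p q} → move p q ∈ arcs (path k) → (p , q) ∈ movesᵀ
          path⊆moves {p} {q} pq∈ =
            let pq = arcs-hasArc (path k) pq∈
                p∈ , q∈ = timeExpanded-bounded (Dᵏ k) (move p q) pq
            in ∈-moves⁺ (D-T C I) p∈ q∈ (_⊆ᴳ_.arcs (Dᵏ⊆D k) (proj₁ pq) , proj₂ pq)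

        load-bound : ∀ k b → q k * count (uncurry move b) (arcs (route k)) ≤
                             fibreSum movesᵀ (λ a → q k * x k (uncurry move a)) b
        load-bound k b = ≤-trans (*-monoʳ-≤ (q k) (flow-bound k b))
          (≤-reflexive (*-fibreSum (q k) movesᵀ (λ a → x k (uncurry move a)) b))

        -- Arcs with the same rounding join the same locations and share the unit capacity `u v w`,
        -- so their capacity constraints can be added up.
        roundSolution-capacity : ∀ v t w t′ →
          ∑ℕ (allFin κ) (λ k → q k * count (move (v , t) (w , t′)) (arcs (route k))) ≤
          u v w * fibreSum movesᵀ (uncurry y) ((v , t) , (w , t′))
        roundSolution-capacity v t w t′ = begin
          ∑ℕ (allFin κ) (λ k → q k * count (uncurry move m) (arcs (route k)))
            ≤⟨ ∑ℕ-mono (allFin κ) (λ {k} _ → load-bound k m) ⟩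
          ∑ℕ (allFin κ) (λ k → fibreSum movesᵀ (λ a → q k * x k (uncurry move a)) m)
            ≡⟨ ∑ℕ-fibreSum (allFin κ) movesᵀ (λ k a → q k * x k (uncurry move a)) m ⟩
          fibreSum movesᵀ (λ a → ∑ℕ (allFin κ) (λ k → q k * x k (uncurry move a))) m
            ≤⟨ fibreSum-mono movesᵀ (λ a → ∑ℕ (allFin κ) (λ k → q k * x k (uncurry move a)))
                 (λ a → u v w * uncurry y a) m
                 (λ { a∈ refl → capacity (∈-moves⁻ (D-T C I) a∈) }) ⟩
          fibreSum movesᵀ (λ a → u v w * uncurry y a) m
            ≡⟨ *-fibreSum (u v w) movesᵀ (uncurry y) m ⟨
          u v w * fibreSum movesᵀ (uncurry y) m ∎
          where
          open ≤-Reasoning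
          m = (v , t) , (w , t′)

        roundSolution-isFlowDesign : IsFlowDesign C I D-S D-Sᵏ roundSolution
        roundSolution-isFlowDesign = record
          { conservation = λ k p _ → unit-balance k (origin≢dest k) p
              (walk-conservation (D-Sᵏ k) (restricted-bounded (Dᵏ k)) (route k) p)
          ; capacity = λ {v} {t} {w} {t′} _ → roundSolution-capacity v t w t′
          ; binary   = λ k a _ → zero-or-one
              (count≤1 (simple⇒unique (route k) (proj₁ (proj₂ (routing k)))) a)
          ; outside  = λ k a ¬a → count-∉ {a = a} (arcs (route k)) (¬a ∘ arcs-hasArc (route k))
          }
          where
          origin≢dest : ∀ k → origin k ≢ dest k
          origin≢dest k o≡d = <⇒≢ (proj₁ (flow-walk feasible k (r≤T k))) (cong proj₂ o≡d)
          zero-or-one : ∀ {m} → m ≤ 1 → m ≡ 0 ⊎ m ≡ 1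
          zero-or-one z≤n       = inj₁ refl
          zero-or-one (s≤s z≤n) = inj₂ refl

        roundSolution-duration : WithinDuration C I S roundSolution
        roundSolution-duration k = begin
          ℤ.+ ∑ℕ (moves C I (D-Sᵏ k))
                 (λ m → transitTime m * count (uncurry move m) (arcs (route k)))
            ≡⟨ cong ℤ.+_ (∑ℕ-moves transitTime (moves-unique (D-Sᵏ k)) route⊆moves) ⟩
          ℤ.+ ∑ℕ (arcs (route k)) (moveWeight transitTime)
            ≤⟨ ℤ.+≤+ (m+n≤o⇒m≤o∸n _ (≤-trans
                 -- Rounding keeps locations, so `transitTime ∘ roundMove` reduces to `transitTime`.
                 (+-monoˡ-≤ (r k) (proj₂ (proj₂ (routing k)) transitTime))
                 (walk-duration (Dᵏ⊆D k) (path k)))) ⟩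
          ℤ.+ (l k ∸ r k)
            -- Truncated and integer subtraction agree here because the release precedes the
            -- deadline.
            ≡⟨ trans (ℤ.m-n≡m⊖n (l k) (r k)) (ℤ.⊖-≥ r≤l) ⟨
          ℤ.+ l k ℤ.- ℤ.+ r k ∎
          where
          open ℤ.≤-Reasoning
          r≤l : r k ≤ l k
          r≤l = <⇒≤ (proj₁ (flow-walk feasible k (r≤T k)))
          route⊆moves : ∀ {p q} → move p q ∈ arcs (route k) → (p , q) ∈ moves C I (D-Sᵏ k)
          route⊆moves {p} {q} pq∈ =
            let pq = arcs-hasArc (route k) pq∈
                p∈ , q∈ = restricted-bounded (Dᵏ k) (move p q) pq
            in ∈-moves⁺ (D-Sᵏ k) p∈ q∈ pq

        -- Cost of the rounded solution

        private
          open OrderedAbelianGroup C using (Carrier; 0#; _≤ᶜ_; ∑; _·_)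
          open CostSums C

          movesˢ = moves C I D-S

          fixedCost : TimedNode n × TimedNode n → Carrier
          fixedCost ((v , _) , (w , _)) = f v w

          unitCost : Commodity → TimedNode n × TimedNode n → Carrier
          unitCost k ((v , _) , (w , _)) = cost k v w

          load : Commodity → TimedNode n × TimedNode n → ℕ
          load k m = q k * x k (uncurry move m)

          loadˢ : Commodity → TimedNode n × TimedNode n → ℕ
          loadˢ k m = q k * count (uncurry move m) (arcs (route k))

          movesˢ-arc : ∀ m → m ∈ movesˢ → Arc (proj₁ (proj₁ m)) (proj₁ (proj₂ m))
          movesˢ-arc m m∈ = proj₁ (moveˢ (∈-moves⁻ D-S m∈))

        roundSolution-fixedCost :
          ∑ movesˢ (λ m → fibreSum movesᵀ (uncurry y) m · fixedCost m) ≤ᶜ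
          ∑ movesᵀ (λ m → uncurry y m · fixedCost m)
        roundSolution-fixedCost = ∑-fibreSum-≤ _≟ᴹ_ roundMove
          (moves-unique D-S) roundMove-moves (fibreSum movesᵀ (uncurry y)) (uncurry y) fixedCost
          (λ m m∈ → proj₁ (f-pos (movesˢ-arc m m∈))) (λ _ → ≤-refl)

        -- Interchanging the sums isolates one commodity, whose new load on each arc is at most the
        -- pushforward of its old load.
        roundSolution-flowCost :
          ∑ movesˢ (λ m → ∑ (allFin κ) λ k → loadˢ k m · unitCost k m) ≤ᶜ
          ∑ movesᵀ (λ m → ∑ (allFin κ) λ k → load k m · unitCost k m)
        roundSolution-flowCost = begin
          ∑ movesˢ (λ m → ∑ (allFin κ) λ k → loadˢ k m · unitCost k m)
            ≈⟨ ∑-swap movesˢ (allFin κ) (λ m k → loadˢ k m · unitCost k m) ⟩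
          ∑ (allFin κ) (λ k → ∑ movesˢ λ m → loadˢ k m · unitCost k m)
            ≤⟨ ∑-mono (allFin κ) (λ {k} _ → ∑-fibreSum-≤ _≟ᴹ_ roundMove
                 (moves-unique D-S) roundMove-moves (loadˢ k) (load k) (unitCost k)
                 (λ m m∈ → proj₁ (c-pos k (movesˢ-arc m m∈))) (load-bound k)) ⟩
          ∑ (allFin κ) (λ k → ∑ movesᵀ λ m → load k m · unitCost k m)
            ≈⟨ ∑-swap (allFin κ) movesᵀ (λ k m → load k m · unitCost k m) ⟩
          ∑ movesᵀ (λ m → ∑ (allFin κ) λ k → load k m · unitCost k m) ∎
          where open ≤-Reasoningᶜ

        roundSolution-cost : totalCost C I D-S roundSolution ≤ᶜ totalCost C I (D-T C I) s
        roundSolution-cost = ⊕-mono-≤ roundSolution-fixedCost roundSolution-flowCost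

      SND-RR-S-relaxes : ∀ s → MinimizationProgram.Feasible (SND-RR-T C I) s →
        ∃ λ s′ → MinimizationProgram.Feasible (SND-RR-S C I S) s′ ×
                 OrderedAbelianGroup._≤ᶜ_ C (MinimizationProgram.cost (SND-RR-S C I S) s′)
                                            (MinimizationProgram.cost (SND-RR-T C I) s)
      SND-RR-S-relaxes s feasible =
        roundSolution feasible ,
        (roundSolution-isFlowDesign feasible , roundSolution-duration feasible) ,
        roundSolution-cost feasible

theorem1 : ∀ {c ℓ₁ ℓ₂} (C : OrderedAbelianGroup c ℓ₁ ℓ₂) (I : Instance C)
    (S : PartialNetwork C I) → P1 C I S → P2 C I S →
    ∀ {zS zT} → IsOptimalValue C (SND-RR-S C I S) zS →
    IsOptimalValue C (SND-RR-T C I) zT →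
    OrderedAbelianGroup._≤⁺_ C zS zT
theorem1 C I S p1 p2 =
  relaxation-≤ (SND-RR-S C I S) (SND-RR-T C I) (SND-RR-S-relaxes C I S p1 p2)
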